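{- Let $S$ be a finite set of non-zero integers with a choice of signs $\theta:S\to\{ -1,1\}$, and let $f,d$ be integers with $1\le f\le d$ and $(f,d)=1$. Let $$C(S,\theta,d)=\sum_{T\in\mathcal{D}_i}\left(\frac{\mathrm{sqf}(T)}{f}\right)\theta(T),$$ where $i=2$ if $4\nmid d$, $i=1$ if $4\mid d$ and $8\nmid d$, and $i=0$ if $8\mid d$. Then $C(S,\theta,d)\ge 0$. Moreover: (i) if $4\nmid d$, then $C(S,\theta,d)>0$ if and only if $\theta(T)=\left(\frac{\mathrm{sqf}(T)}{f}\right)$ for every $T\in\mathcal{D}_2$; (ii) if $4\mid d$ and $8\nmid d$, then $C(S,\theta,d)>0$ if and only if $\theta(T)=\left(\frac{\mathrm{sqf}(T)}{f}\right)$ for every $T\in\mathcal{D}_1$; (iii) if $8\mid d$, then $C(S,\theta,d)>0$ if and only if $\theta(T)=\left(\frac{\mathrm{sqf}(T)}{f}\right)$ for every $T\in\mathcal{D}_0$.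
   Context: For a non-zero integer $n$, $\mathrm{sqf}(n)$ is its squarefree part: the unique squarefree integer $s$ (of the same sign as $n$) with $n=sm^2$ for some integer $m$. For a finite set $T$ of non-zero integers, $\mathrm{sqf}(T)=\mathrm{sqf}\left(\prod_{s\in T}s\right)$, and $\mathrm{sqf}(\emptyset)=1$. For $T\subseteq S$, $\theta(T)=\prod_{s\in T}\theta(s)$, with $\theta(\emptyset)=1$. For a positive integer $f$, $\left(\frac{\cdot}{f}\right)$ is the Jacobi symbol (Kronecker symbol if $f$ is even). Define $\mathcal{D}_0=\{T\subseteq S:\mathrm{sqf}(T)\mid d\}$, $\mathcal{D}_1=\{T\in\mathcal{D}_0:\mathrm{sqf}(T)\equiv 1\text{ or }3\ (\mathrm{mod}\ 4)\}$, $\mathcal{D}_2=\{T\in\mathcal{D}_0:\mathrm{sqf}(T)\equiv 1\ (\mathrm{mod}\ 4)\}$. The constant $C(S,\theta,d)$ also depends on $f$, although this is not displayed. -}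

module Defs where

open import Data.Fin.Base using (Fin; zero; suc; toℕ; fromℕ<)
open import Data.Fin.Properties using (any?; toℕ-fromℕ<)
open import Data.Fin.Subset using (Subset; inside; outside)
open import Data.Integer.Base using (ℤ; +_; +[1+_]; -[1+_]; 0ℤ; 1ℤ; -1ℤ; _+_; _-_; _*_; ∣_∣; sign; _◃_; NonZero)
open import Data.Integer.Divisibility using (_∣_)
import Data.Integer.Properties as ℤ
open import Data.List.Base using (List; []; _∷_; map; filter; foldr; _++_)
open import Data.Nat.Base as ℕ using (ℕ)
import Data.Nat.Coprimality as Coprimality
import Data.Nat.Divisibility as ℕ
open import Data.Nat.GCD using (gcd; gcd[m,n]≢0; gcd[m,n]∣m; gcd[m,n]∣n)
open import Data.Nat.Induction using (<-rec)
open import Data.Nat.Primality.Factorisation using (factors; factorise)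
import Data.Nat.Properties as ℕ
open import Data.Nat.Tactic.RingSolver using (solve-∀)
open import Data.Product.Base using (∃; Σ; _×_; _,_; proj₁; proj₂)
open import Data.Sign.Base as Sign using (Sign)
import Data.Sign.Properties as Sign
open import Data.Sum.Base using (_⊎_; inj₁; inj₂)
open import Data.Vec.Base using ([]; _∷_)
open import Function.Base using (_∘_)
open import Function.Definitions using (Injective)
open import Level using (0ℓ)
open import Relation.Binary.PropositionalEquality
open import Relation.Nullary using (Dec; yes; no; contradiction)
open import Relation.Nullary.Decidable using (_×-dec_; _⊎-dec_)
open import Relation.Unary using (Pred; Decidable)

infix 4 _≡_[mod_]

_≡_[mod_] : ℤ → ℤ → ℕ → Set
a ≡ b [mod m ] = + m ∣ a - b

≡mod? : ∀ a b m → Dec (a ≡ b [mod m ])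
≡mod? a b m = m ℕ.∣? ∣ a - b ∣

Squarefreeℕ : ℕ → Set
Squarefreeℕ n = ∀ k → k ℕ.* k ℕ.∣ n → k ≡ 1

Squarefree : ℤ → Set
Squarefree n = Squarefreeℕ ∣ n ∣

-- For n ≠ 0 the sign of the squarefree part is forced by the equation.
record SquarefreeDecomposition (n : ℤ) : Set where
  field
    part       : ℤ
    root       : ℤ
    squarefree : Squarefree part
    equation   : n ≡ part * (root * root)

private
  Decompositionℕ : ℕ → Set
  Decompositionℕ n = Σ ℕ λ s → Σ ℕ λ m → Squarefreeℕ s × n ≡ s ℕ.* (m ℕ.* m)

  decomposeℕ : ∀ n → .(ℕ.NonZero n) → Decompositionℕ n
  decomposeℕ = <-rec _ step
    where
    regroup : ∀ s m k → s ℕ.* (m ℕ.* m) ℕ.* (k ℕ.* k) ≡ s ℕ.* ((m ℕ.* k) ℕ.* (m ℕ.* k))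
    regroup = solve-∀

    step : ∀ n → (∀ {q} → q ℕ.< n → .(ℕ.NonZero q) → Decompositionℕ q) →
           .(ℕ.NonZero n) → Decompositionℕ n
    step n@(ℕ.suc _) rec _
      with any? {n = ℕ.suc n} (λ k → (1 ℕ.<? toℕ k) ×-dec (toℕ k ℕ.* toℕ k ℕ.∣? n))
    ... | yes (i , 1<k , k²∣n) = s , m ℕ.* k , sf , trans n≡qk² (trans (cong (ℕ._* (k ℕ.* k)) q≡) (regroup s m k))
      where
      k = toℕ i
      q = ℕ.quotient k²∣n
      n≡qk² : n ≡ q ℕ.* (k ℕ.* k)
      n≡qk² = ℕ.m∣n⇒n≡quotient*m k²∣n
      1<k² : 1 ℕ.< k ℕ.* k
      1<k² = ℕ.*-mono-< 1<k 1<k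
      q<n : q ℕ.< n
      q<n = ℕ.quotient-< k²∣n {{ℕ.n>1⇒nonTrivial 1<k²}}
      ih = rec q<n (ℕ.quotient≢0 k²∣n)
      s = proj₁ ih
      m = proj₁ (proj₂ ih)
      sf = proj₁ (proj₂ (proj₂ ih))
      q≡ = proj₂ (proj₂ (proj₂ ih))
    ... | no ¬∃ = n , 1 , sf , sym (ℕ.*-identityʳ n)
      where
      sf : Squarefreeℕ n
      sf 0 0∣n = contradiction (ℕ.0∣⇒≡0 0∣n) λ ()
      sf 1 _ = refl
      sf k@(ℕ.2+ _) k²∣n = contradiction (fromℕ< k<1+n , subst Q (sym (toℕ-fromℕ< k<1+n)) (ℕ.s<s ℕ.z<s , k²∣n)) ¬∃
        where
        Q : ℕ → Set
        Q j = 1 ℕ.< j × j ℕ.* j ℕ.∣ n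
        k<1+n : k ℕ.< ℕ.suc n
        k<1+n = ℕ.s≤s (ℕ.≤-trans (ℕ.m≤m*n k k) (ℕ.∣⇒≤ k²∣n))

decompose : ∀ n → .{{NonZero n}} → SquarefreeDecomposition n
decompose n {{nz}} with s , m , sf , eq ← decomposeℕ ∣ n ∣ nz = record
  { part       = sign n ◃ s
  ; root       = + m
  ; squarefree = subst Squarefreeℕ (sym (ℤ.abs-◃ (sign n) s)) sf
  ; equation   = begin
      n                                       ≡⟨ ℤ.◃-inverse n ⟨
      sign n ◃ ∣ n ∣                          ≡⟨ cong₂ _◃_ (sym (Sign.*-identityʳ (sign n))) eq ⟩
      (sign n Sign.* Sign.+) ◃ s ℕ.* (m ℕ.* m) ≡⟨ ℤ.◃-distrib-* (sign n) Sign.+ s (m ℕ.* m) ⟩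
      (sign n ◃ s) * (Sign.+ ◃ m ℕ.* m)       ∎
  }
  where open ≡-Reasoning

sqf : ∀ n → .{{NonZero n}} → ℤ
sqf n = SquarefreeDecomposition.part (decompose n)

private
  root∣ : ∀ {s t m k} .{{_ : ℕ.NonZero m}} → Squarefreeℕ t →
          s ℕ.* (m ℕ.* m) ≡ t ℕ.* (k ℕ.* k) → m ℕ.∣ k
  root∣ {s} {t} {m} {k} sf eq = subst (ℕ._∣ k) (sym m≡g) (gcd[m,n]∣n m k)
    where
    g = gcd m k
    instance
      g≢0 : ℕ.NonZero g
      g≢0 = ℕ.≢-nonZero (gcd[m,n]≢0 m k (inj₁ (ℕ.≢-nonZero⁻¹ m)))
      g²≢0 : ℕ.NonZero (g ℕ.* g)
      g²≢0 = ℕ.m*n≢0 g g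
    m′ = ℕ.quotient (gcd[m,n]∣m m k)
    k′ = ℕ.quotient (gcd[m,n]∣n m k)
    m≡ : m ≡ m′ ℕ.* g
    m≡ = ℕ.m∣n⇒n≡quotient*m (gcd[m,n]∣m m k)
    k≡ : k ≡ k′ ℕ.* g
    k≡ = ℕ.m∣n⇒n≡quotient*m (gcd[m,n]∣n m k)
    coprime : Coprimality.Coprime m′ k′
    coprime = subst₂ Coprimality.Coprime (ℕ.n/m≡quotient (gcd[m,n]∣m m k)) (ℕ.n/m≡quotient (gcd[m,n]∣n m k)) (Coprimality.coprime-/gcd m k)
    regroup : ∀ a b c → a ℕ.* ((b ℕ.* c) ℕ.* (b ℕ.* c)) ≡ a ℕ.* (b ℕ.* b) ℕ.* (c ℕ.* c)
    regroup = solve-∀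
    eq′ : s ℕ.* (m′ ℕ.* m′) ≡ t ℕ.* (k′ ℕ.* k′)
    eq′ = ℕ.*-cancelʳ-≡ _ _ (g ℕ.* g) (begin
      s ℕ.* (m′ ℕ.* m′) ℕ.* (g ℕ.* g)         ≡⟨ regroup s m′ g ⟨
      s ℕ.* ((m′ ℕ.* g) ℕ.* (m′ ℕ.* g))       ≡⟨ cong (λ x → s ℕ.* (x ℕ.* x)) m≡ ⟨
      s ℕ.* (m ℕ.* m)                         ≡⟨ eq ⟩
      t ℕ.* (k ℕ.* k)                         ≡⟨ cong (λ x → t ℕ.* (x ℕ.* x)) k≡ ⟩
      t ℕ.* ((k′ ℕ.* g) ℕ.* (k′ ℕ.* g))       ≡⟨ regroup t k′ g ⟩
      t ℕ.* (k′ ℕ.* k′) ℕ.* (g ℕ.* g)         ∎)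
      where open ≡-Reasoning
    coprime-*ʳ : ∀ {a b c} → Coprimality.Coprime a b → Coprimality.Coprime a c → Coprimality.Coprime a (b ℕ.* c)
    coprime-*ʳ ab ac (d∣a , d∣bc) =
      ac (d∣a , Coprimality.coprime-divisor (λ (e∣d , e∣b) → ab (ℕ.∣-trans e∣d d∣a , e∣b)) d∣bc)
    coprime² : Coprimality.Coprime (m′ ℕ.* m′) (k′ ℕ.* k′)
    coprime² = Coprimality.sym (coprime-*ʳ c c)
      where c = Coprimality.sym (coprime-*ʳ coprime coprime)
    m′²∣t : m′ ℕ.* m′ ℕ.∣ t
    m′²∣t = Coprimality.coprime-divisor coprime² (ℕ.divides s (trans (ℕ.*-comm (k′ ℕ.* k′) t) (sym eq′)))
    m≡g : m ≡ g
    m≡g = trans m≡ (trans (cong (ℕ._* g) (sf m′ m′²∣t)) (ℕ.*-identityˡ g))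

  recompute : ∀ n → .(NonZero n) → NonZero n
  recompute +[1+ _ ] _ = _
  recompute -[1+ _ ] _ = _

  sign-square : ∀ s m → .{{NonZero (s * (m * m))}} → sign (s * (m * m)) ≡ sign s
  sign-square s m {{nz}} = begin
    sign (s * (m * m))                        ≡⟨ ℤ.sign-* s (m * m) ⟩
    sign s Sign.* sign (m * m)                ≡⟨ cong (sign s Sign.*_) (ℤ.sign-* m m {{m²≢0}}) ⟩
    sign s Sign.* (sign m Sign.* sign m)      ≡⟨ cong (sign s Sign.*_) (Sign.s*s≡+ (sign m)) ⟩
    sign s Sign.* Sign.+                      ≡⟨ Sign.*-identityʳ (sign s) ⟩
    sign s                                    ∎
    where
    open ≡-Reasoning
    m²≢0 : NonZero (m * m)
    m²≢0 = ℕ.m*n≢0⇒n≢0 ∣ s ∣ {{subst ℕ.NonZero (ℤ.abs-* s (m * m)) nz}}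

sqf-unique : ∀ {n} .{{_ : NonZero n}} {s m} → Squarefree s → n ≡ s * (m * m) → s ≡ sqf n
sqf-unique {n} {{nz}} {s} {m} sf eq = ℤ.◃-cong sign≡ abs≡
  where
  open SquarefreeDecomposition (decompose n) renaming (part to t; root to k)
  instance
    nz₁ : NonZero (s * (m * m))
    nz₁ = subst NonZero eq (recompute n nz)
    nz₂ : NonZero (t * (k * k))
    nz₂ = subst NonZero equation (recompute n nz)
  sign≡ : sign s ≡ sign t
  sign≡ = trans (sym (sign-square s m)) (trans (cong sign (trans (sym eq) equation)) (sign-square t k))
  abs-square : ∀ a b → ∣ a * (b * b) ∣ ≡ ∣ a ∣ ℕ.* (∣ b ∣ ℕ.* ∣ b ∣)
  abs-square a b = trans (ℤ.abs-* a (b * b)) (cong (∣ a ∣ ℕ.*_) (ℤ.abs-* b b))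
  root≢0 : ∀ a b → NonZero (a * (b * b)) → NonZero b
  root≢0 a b p = ℕ.m*n≢0⇒n≢0 ∣ b ∣ {{ℕ.m*n≢0⇒n≢0 ∣ a ∣ {{subst ℕ.NonZero (abs-square a b) p}}}}
  eqℕ : ∣ s ∣ ℕ.* (∣ m ∣ ℕ.* ∣ m ∣) ≡ ∣ t ∣ ℕ.* (∣ k ∣ ℕ.* ∣ k ∣)
  eqℕ = trans (sym (abs-square s m)) (trans (cong ∣_∣ (trans (sym eq) equation)) (abs-square t k))
  instance
    m≢0 : NonZero m
    m≢0 = root≢0 s m nz₁
    k≢0 : NonZero k
    k≢0 = root≢0 t k nz₂
    m²≢0 : ℕ.NonZero (∣ m ∣ ℕ.* ∣ m ∣)
    m²≢0 = ℕ.m*n≢0 ∣ m ∣ ∣ m ∣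
  m≡k : ∣ m ∣ ≡ ∣ k ∣
  m≡k = ℕ.∣-antisym (root∣ {s = ∣ s ∣} squarefree eqℕ) (root∣ {s = ∣ t ∣} sf (sym eqℕ))
  abs≡ : ∣ s ∣ ≡ ∣ t ∣
  abs≡ = ℕ.*-cancelʳ-≡ _ _ (∣ m ∣ ℕ.* ∣ m ∣) (trans eqℕ (cong (λ x → ∣ t ∣ ℕ.* (x ℕ.* x)) (sym m≡k)))

-- The residue classes mod p are represented by 0, …, p - 1.
IsSquareMod : ℕ → ℤ → Set
IsSquareMod p a = ∃ λ (x : Fin p) → + toℕ x * + toℕ x ≡ a [mod p ]

isSquareMod? : ∀ p a → Dec (IsSquareMod p a)
isSquareMod? p a = any? λ x → ≡mod? (+ toℕ x * + toℕ x) a p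

legendre : ℤ → ℕ → ℤ
legendre a p with p ℕ.∣? ∣ a ∣ | isSquareMod? p a
... | yes _ | _     = 0ℤ
... | no _  | yes _ = 1ℤ
... | no _  | no _  = -1ℤ

kronecker₂ : ℤ → ℤ
kronecker₂ a with 2 ℕ.∣? ∣ a ∣ | ≡mod? a 1ℤ 8 ⊎-dec ≡mod? a -1ℤ 8
... | yes _ | _     = 0ℤ
... | no _  | yes _ = 1ℤ
... | no _  | no _  = -1ℤ

kroneckerPrime : ℤ → ℕ → ℤ
kroneckerPrime a 2 = kronecker₂ a
kroneckerPrime a p = legendre a p

-- For odd f this is the Jacobi symbol.
kronecker : ℤ → (f : ℕ) → .{{ℕ.NonZero f}} → ℤ
kronecker a f = foldr _*_ 1ℤ (map (kroneckerPrime a) (factors (factorise f)))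

∏ : ∀ {n} → Subset n → (Fin n → ℤ) → ℤ
∏ []            g = 1ℤ
∏ (inside  ∷ T) g = g zero * ∏ T (g ∘ suc)
∏ (outside ∷ T) g = ∏ T (g ∘ suc)

∏-nonZero : ∀ {n} (T : Subset n) {g} → (∀ i → NonZero (g i)) → NonZero (∏ T g)
∏-nonZero []            nz = _
∏-nonZero (inside  ∷ T) {g} nz =
  ℤ.i*j≢0 (g zero) (∏ T (g ∘ suc)) {{nz zero}} {{∏-nonZero T (nz ∘ suc)}}
∏-nonZero (outside ∷ T) nz = ∏-nonZero T (nz ∘ suc)

subsets : ∀ n → List (Subset n)
subsets ℕ.zero    = [] ∷ []
subsets (ℕ.suc n) = map (inside ∷_) (subsets n) ++ map (outside ∷_) (subsets n)

∑ : ∀ {n} {P : Pred (Subset n) 0ℓ} → Decidable P → (Subset n → ℤ) → ℤ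
∑ {n} P? g = foldr _+_ 0ℤ (map g (filter P? (subsets n)))

-- Injectivity makes `Subset size` the power set of the enumerated set.
record NonZeroIntegers : Set where
  field
    size      : ℕ
    element   : Fin size → ℤ
    injective : Injective _≡_ _≡_ element
    nonZero   : ∀ i → NonZero (element i)

module _ (S : NonZeroIntegers) where
  open NonZeroIntegers S

  sqfSet : Subset size → ℤ
  sqfSet T = sqf (∏ T element) {{∏-nonZero T nonZero}}

  signSet : (Fin size → Sign) → Subset size → ℤ
  signSet θ T = ∏ T (λ i → θ i ◃ 1)

  𝒟₀ 𝒟₁ 𝒟₂ : ℕ → Pred (Subset size) 0ℓ
  𝒟₀ d T = sqfSet T ∣ + d
  𝒟₁ d T = 𝒟₀ d T × (sqfSet T ≡ + 1 [mod 4 ] ⊎ sqfSet T ≡ + 3 [mod 4 ])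
  𝒟₂ d T = 𝒟₀ d T × sqfSet T ≡ + 1 [mod 4 ]

  𝒟₀? : ∀ d → Decidable (𝒟₀ d)
  𝒟₀? d T = ∣ sqfSet T ∣ ℕ.∣? d

  𝒟₁? : ∀ d → Decidable (𝒟₁ d)
  𝒟₁? d T = 𝒟₀? d T ×-dec (≡mod? (sqfSet T) (+ 1) 4 ⊎-dec ≡mod? (sqfSet T) (+ 3) 4)

  𝒟₂? : ∀ d → Decidable (𝒟₂ d)
  𝒟₂? d T = 𝒟₀? d T ×-dec ≡mod? (sqfSet T) (+ 1) 4

  C : (Fin size → Sign) → (f d : ℕ) → .{{ℕ.NonZero f}} → ℤ
  C θ f d with 4 ℕ.∣? d | 8 ℕ.∣? d
  ... | no _  | _     = ∑ (𝒟₂? d) (λ T → kronecker (sqfSet T) f * signSet θ T)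
  ... | yes _ | no _  = ∑ (𝒟₁? d) (λ T → kronecker (sqfSet T) f * signSet θ T)
  ... | yes _ | yes _ = ∑ (𝒟₀? d) (λ T → kronecker (sqfSet T) f * signSet θ T)

{-# OPTIONS --safe #-}

-- Each 𝒟ᵢ is closed under symmetric difference, and on it T ↦ (sqf(T)/f) θ(T) is a character with values ±1:
-- sqf(T) sqf(U) and sqf(T △ U) differ by a square, sqf(T) is prime to f, and the Kronecker symbol is
-- multiplicative.  A character sum is the order of the group if the character is trivial and 0 otherwise.

module Submission where

open import Defs
open import Data.Bool.Base using (_xor_; if_then_else_)
open import Data.Fin.Base using (Fin; zero; suc; toℕ; fromℕ<; punchOut; combine; remQuot)
open import Data.Fin.Properties using (all?; toℕ<n; toℕ-fromℕ<; toℕ-injective; punchOut-injective; combine-remQuot; injective⇒≤)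
open import Data.Fin.Subset using (Subset; inside; outside; _∩_; ⊥)
open import Data.Fin.Subset.Properties using (anySubset?)
open import Data.Integer.Base using (ℤ; +_; -[1+_]; 0ℤ; 1ℤ; -1ℤ; _+_; _-_; -_; _*_; ∣_∣; NonZero; _≤_; _<_; +≤+; +<+; _◃_)
open import Data.Integer.DivMod using (_/ℕ_; n%ℕd<d; a≡a%ℕn+[a/ℕn]*n)
open import Data.Integer.Divisibility.Signed as Signed using (∣ᵤ⇒∣; ∣⇒∣ᵤ)
import Data.Integer.Properties as ℤ
open import Data.Integer.Tactic.RingSolver using (solve-∀)
open import Data.List.Base using (List; []; _∷_; foldr; map; filter; _++_)
open import Data.List.Membership.Propositional using (_∈_)
open import Data.List.Membership.Propositional.Properties using (∈-map⁺; ∈-++⁺ˡ; ∈-++⁺ʳ)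
import Data.List.Properties as List
open import Data.List.Relation.Unary.All using (All; []; _∷_)
open import Data.List.Relation.Unary.Any using (here; there)
open import Data.Nat.Base as ℕ using (ℕ)
open import Data.Nat.Coprimality as Coprimality using (Coprime; coprime-Bézout; coprime-divisor)
open import Data.Nat.Divisibility as ℕ using (_∣_; _∤_)
open import Data.Nat.DivMod using (m≡m%n+[m/n]*n; m%n<n; m/n*n≡m)
open import Data.Nat.GCD using (module Bézout; gcd; gcd[m,n]≢0; gcd[m,n]∣m; gcd[m,n]∣n)
open import Data.Nat.ListAction using (product)
open import Data.Nat.Primality using (Prime; ¬prime[1]; euclidsLemma; prime⇒irreducible; prime⇒nonZero)
open import Data.Nat.Primality.Factorisation using (factorise; module PrimeFactorisation)
import Data.Nat.Properties as ℕ
import Data.Nat.Tactic.RingSolver as ℕSolver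
open import Data.Product.Base using (∃; _×_; _,_; proj₁; proj₂)
open import Data.Sign.Base using (Sign)
open import Data.Sum.Base using (_⊎_; inj₁; inj₂; [_,_]′)
open import Data.Vec.Base using ([]; _∷_; zipWith)
open import Function.Base using (_∘_; id)
open import Function.Bundles using (_⇔_; mk⇔; Equivalence)
open import Level using (0ℓ)
open import Relation.Binary.PropositionalEquality
open import Relation.Nullary using (¬_; Dec; yes; no; contradiction; does)
open import Relation.Nullary.Decidable using (_×-dec_; _⊎-dec_; from-yes; from-no)
open import Relation.Unary using (Pred; Decidable)

-- The costly ingredient is multiplicativity of the symbol in its upper argument. Since `legendre`
-- is defined by the existence of a square root mod p, the crux is that a product of two nonsquares
-- is a square; a count of square classes gives this, without Euler's criterion or a generator of
-- the unit group. At 2 the symbol depends only on the residue mod 8, so a finite check suffices.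
-- The square `v * v` by which sqf(T) sqf(U) exceeds sqf(T △ U) has to be harmless in three
-- respects: for divisibility of d, because a squarefree divisor of d² divides d; for residues mod
-- 4, because a product of odd parts forces `v * v` to be 1 mod 4; for the symbol, because a value
-- ±1 on the product forces ±1 on `v`.

infix 4 _≈_⟨mod_⟩
infixl 6 _△_

-- Congruences between integers

-- Unlike _≡_[mod_], which unfolds to divisibility of an absolute value, the record lets Agda infer a and b.
record _≈_⟨mod_⟩ (a b : ℤ) (m : ℕ) : Set where
  constructor _by_
  field
    quotient : ℤ
    equation : a ≡ b + quotient * + m

module _ {m : ℕ} where

  ≡mod⇒≈ : ∀ a b → a ≡ b [mod m ] → a ≈ b ⟨mod m ⟩
  ≡mod⇒≈ a b m∣a-b with Signed.divides q a-b≡qm ← ∣ᵤ⇒∣ {+ m} {a - b} m∣a-b =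
    q by trans (regroup a b) (cong (_+_ b) a-b≡qm)
    where
    regroup : ∀ a b → a ≡ b + (a - b)
    regroup = solve-∀

  ≈⇒≡mod : ∀ {a b} → a ≈ b ⟨mod m ⟩ → a ≡ b [mod m ]
  ≈⇒≡mod {a} {b} (q by eq) = ∣⇒∣ᵤ {+ m} {a - b} (Signed.divides q (trans (cong (_- b) eq) (regroup b (q * + m))))
    where
    regroup : ∀ b c → b + c - b ≡ c
    regroup = solve-∀

  ≈-reflexive : ∀ {a b} → a ≡ b → a ≈ b ⟨mod m ⟩
  ≈-reflexive {a} refl = 0ℤ by regroup a (+ m)
    where
    regroup : ∀ a m → a ≡ a + 0ℤ * m
    regroup = solve-∀

  ≈-sym : ∀ {a b} → a ≈ b ⟨mod m ⟩ → b ≈ a ⟨mod m ⟩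
  ≈-sym {b = b} (q by refl) = (- q) by regroup b q (+ m)
    where
    regroup : ∀ b q m → b ≡ b + q * m + (- q) * m
    regroup = solve-∀

  ≈-trans : ∀ {a b c} → a ≈ b ⟨mod m ⟩ → b ≈ c ⟨mod m ⟩ → a ≈ c ⟨mod m ⟩
  ≈-trans {c = c} (q by refl) (r by refl) = (r + q) by regroup c r q (+ m)
    where
    regroup : ∀ c r q m → c + r * m + q * m ≡ c + (r + q) * m
    regroup = solve-∀

  *-cong-≈ : ∀ {a b c d} → a ≈ b ⟨mod m ⟩ → c ≈ d ⟨mod m ⟩ → a * c ≈ b * d ⟨mod m ⟩
  *-cong-≈ {b = b} {d = d} (q by refl) (r by refl) =
    (b * r + q * d + q * r * + m) by regroup b d q r (+ m)
    where
    regroup : ∀ b d q r m → (b + q * m) * (d + r * m) ≡ b * d + (b * r + q * d + q * r * m) * m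
    regroup = solve-∀

  *-congˡ-≈ : ∀ c {a b} → a ≈ b ⟨mod m ⟩ → c * a ≈ c * b ⟨mod m ⟩
  *-congˡ-≈ c = *-cong-≈ (≈-reflexive {c} refl)

  ≈0⇒∣ : ∀ {a} → a ≈ 0ℤ ⟨mod m ⟩ → m ∣ ∣ a ∣
  ≈0⇒∣ {a} a≈0 = subst (λ x → m ∣ ∣ x ∣) (ℤ.+-identityʳ a) (≈⇒≡mod a≈0)

  ∣⇒≈0 : ∀ a → m ∣ ∣ a ∣ → a ≈ 0ℤ ⟨mod m ⟩
  ∣⇒≈0 a m∣a = ≡mod⇒≈ a 0ℤ (subst (λ x → m ∣ ∣ x ∣) (sym (ℤ.+-identityʳ a)) m∣a)

  module _ .{{_ : ℕ.NonZero m}} where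

    residue : ℤ → Fin m
    residue a = fromℕ< (n%ℕd<d a m)

    residue-≈ : ∀ a → a ≈ + toℕ (residue a) ⟨mod m ⟩
    residue-≈ a rewrite toℕ-fromℕ< (n%ℕd<d a m) = (a /ℕ m) by a≡a%ℕn+[a/ℕn]*n a m

    residue-injective : ∀ a b → residue a ≡ residue b → a ≈ b ⟨mod m ⟩
    residue-injective a b eq =
      ≈-trans (residue-≈ a) (≈-trans (≈-reflexive (cong (λ r → + toℕ r) eq)) (≈-sym (residue-≈ b)))

∣∧<⇒≡0 : ∀ {m n} → m ∣ n → n ℕ.< m → n ≡ 0
∣∧<⇒≡0 {n = ℕ.zero}  _   _   = refl
∣∧<⇒≡0 {n = ℕ.suc n} m∣n n<m = contradiction m∣n (ℕ.>⇒∤ n<m)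

-- Squares modulo a prime and the values of the Legendre symbol

Square : ℕ → ℤ → Set
Square p a = ∃ λ x → x * x ≈ a ⟨mod p ⟩

module _ {p : ℕ} (pp : Prime p) where

  private instance
    p≢0 : ℕ.NonZero p
    p≢0 = prime⇒nonZero pp

  p∤1 : p ∤ 1
  p∤1 p∣1 = ¬prime[1] (subst Prime (ℕ.∣1⇒≡1 p∣1) pp)

  euclid : ∀ a b → p ∣ ∣ a * b ∣ → (p ∣ ∣ a ∣) ⊎ (p ∣ ∣ b ∣)
  euclid a b p∣ab = euclidsLemma ∣ a ∣ ∣ b ∣ pp (subst (p ∣_) (ℤ.abs-* a b) p∣ab)

  ∤-* : ∀ a b → p ∤ ∣ a ∣ → p ∤ ∣ b ∣ → p ∤ ∣ a * b ∣
  ∤-* a b p∤a p∤b = [ p∤a , p∤b ]′ ∘ euclid a b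

  cancel : ∀ c a b → p ∤ ∣ c ∣ → c * a ≈ c * b ⟨mod p ⟩ → a ≈ b ⟨mod p ⟩
  cancel c a b p∤c ca≈cb with euclid c (a - b) (subst (λ x → p ∣ ∣ x ∣) (regroup c a b) (≈⇒≡mod ca≈cb))
    where
    regroup : ∀ c a b → c * a - c * b ≡ c * (a - b)
    regroup = solve-∀
  ... | inj₁ p∣c   = contradiction p∣c p∤c
  ... | inj₂ p∣a-b = ≡mod⇒≈ a b p∣a-b

  -- Bézout coefficients are natural numbers and come in two shapes, according to which multiple is
  -- the larger. So the inverse is found for the absolute value of `a`, and the sign of `a` is then
  -- moved onto it.
  inverse : ∀ a → p ∤ ∣ a ∣ → ∃ λ b → a * b ≈ 1ℤ ⟨mod p ⟩
  inverse a p∤a = from-abs abs-inverse (ℤ.+∣i∣≡i⊎+∣i∣≡-i a)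
    where
    coprime : Coprime p ∣ a ∣
    coprime (e∣p , e∣a) with prime⇒irreducible pp e∣p
    ... | inj₁ e≡1  = e≡1
    ... | inj₂ refl = contradiction e∣a p∤a
    abs-inverse : ∃ λ b → + ∣ a ∣ * b ≈ 1ℤ ⟨mod p ⟩
    abs-inverse with coprime-Bézout coprime
    ... | Bézout.+- x y eq = - + y , (- + x) by (begin
      + ∣ a ∣ * - + y                        ≡⟨ regroup (+ ∣ a ∣) (+ y) ⟩
      1ℤ + - (1ℤ + + y * + ∣ a ∣)             ≡⟨ cong (λ z → 1ℤ + - (1ℤ + z)) (ℤ.pos-* y ∣ a ∣) ⟨
      1ℤ + - + (1 ℕ.+ y ℕ.* ∣ a ∣)            ≡⟨ cong (λ z → 1ℤ + - + z) eq ⟩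
      1ℤ + - + (x ℕ.* p)                     ≡⟨ cong (λ z → 1ℤ + - z) (ℤ.pos-* x p) ⟩
      1ℤ + - (+ x * + p)                     ≡⟨ cong (_+_ 1ℤ) (ℤ.neg-distribˡ-* (+ x) (+ p)) ⟩
      1ℤ + - + x * + p                       ∎)
      where
      open ≡-Reasoning
      regroup : ∀ a y → a * - y ≡ 1ℤ + - (1ℤ + y * a)
      regroup = solve-∀
    ... | Bézout.-+ x y eq = + y , (+ x) by (begin
      + ∣ a ∣ * + y             ≡⟨ ℤ.*-comm (+ ∣ a ∣) (+ y) ⟩
      + y * + ∣ a ∣             ≡⟨ ℤ.pos-* y ∣ a ∣ ⟨
      + (y ℕ.* ∣ a ∣)           ≡⟨ cong +_ eq ⟨
      + (1 ℕ.+ x ℕ.* p)         ≡⟨ cong (_+_ 1ℤ) (ℤ.pos-* x p) ⟩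
      1ℤ + + x * + p            ∎)
      where open ≡-Reasoning
    from-abs : (∃ λ b → + ∣ a ∣ * b ≈ 1ℤ ⟨mod p ⟩) → + ∣ a ∣ ≡ a ⊎ + ∣ a ∣ ≡ - a →
               ∃ λ b → a * b ≈ 1ℤ ⟨mod p ⟩
    from-abs (b , nb≈1) (inj₁ eq) = b , subst (λ n → n * b ≈ 1ℤ ⟨mod p ⟩) eq nb≈1
    from-abs (b , nb≈1) (inj₂ eq) = - b , ≈-trans (≈-reflexive (trans (regroup a b) (cong (_* b) (sym eq)))) nb≈1
      where
      regroup : ∀ a b → a * - b ≡ - a * b
      regroup = solve-∀

  -- The root x of a y² is divided by y: if z inverts y, then (x z)² ≈ a (y z)² ≈ a.
  square-cancel : ∀ a y → p ∤ ∣ y ∣ → Square p (a * (y * y)) → Square p a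
  square-cancel a y p∤y (x , x²≈ay²) with z , yz≈1 ← inverse y p∤y = x * z ,
    ≈-trans (≈-reflexive (regroup₁ x z)) (
    ≈-trans (*-cong-≈ x²≈ay² (≈-reflexive {a = z * z} refl)) (
    ≈-trans (≈-reflexive (regroup₂ a y z)) (
    ≈-trans (*-congˡ-≈ a (*-cong-≈ yz≈1 yz≈1)) (≈-reflexive (ℤ.*-identityʳ a)))))
    where
    regroup₁ : ∀ x z → x * z * (x * z) ≡ x * x * (z * z)
    regroup₁ = solve-∀
    regroup₂ : ∀ a y z → a * (y * y) * (z * z) ≡ a * ((y * z) * (y * z))
    regroup₂ = solve-∀

  square-∤ : ∀ a x → p ∤ ∣ a ∣ → x * x ≈ a ⟨mod p ⟩ → p ∤ ∣ x ∣
  square-∤ a x p∤a x²≈a p∣x =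
    p∤a (≈0⇒∣ (≈-trans (≈-sym x²≈a) (*-cong-≈ (∣⇒≈0 x p∣x) (∣⇒≈0 x p∣x))))

  -- `IsSquareMod` admits only the roots 0, ..., p - 1 and is therefore decidable; `Square` admits
  -- all integers, so that roots can be multiplied and divided freely. Reducing a root mod p passes
  -- from one to the other.
  Square⇒IsSquareMod : ∀ {a} → Square p a → IsSquareMod p a
  Square⇒IsSquareMod (x , x²≈a) = residue x ,
    ≈⇒≡mod (≈-trans (*-cong-≈ (≈-sym (residue-≈ x)) (≈-sym (residue-≈ x))) x²≈a)

  legendre-∣ : ∀ {a} → p ∣ ∣ a ∣ → legendre a p ≡ 0ℤ
  legendre-∣ {a} p∣a with p ℕ.∣? ∣ a ∣ | isSquareMod? p a
  ... | yes _  | _ = refl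
  ... | no p∤a | _ = contradiction p∣a p∤a

  legendre-square : ∀ {a} → p ∤ ∣ a ∣ → Square p a → legendre a p ≡ 1ℤ
  legendre-square {a} p∤a sq with p ℕ.∣? ∣ a ∣ | isSquareMod? p a
  ... | yes p∣a | _      = contradiction p∣a p∤a
  ... | no _    | yes _  = refl
  ... | no _    | no ¬sq = contradiction (Square⇒IsSquareMod sq) ¬sq

  legendre-nonSquare : ∀ {a} → p ∤ ∣ a ∣ → ¬ Square p a → legendre a p ≡ -1ℤ
  legendre-nonSquare {a} p∤a ¬sq with p ℕ.∣? ∣ a ∣ | isSquareMod? p a
  ... | yes p∣a | _              = contradiction p∣a p∤a
  ... | no _    | yes (x , x²≡a) = contradiction (+ toℕ x , ≡mod⇒≈ (+ toℕ x * + toℕ x) a x²≡a) ¬sq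
  ... | no _    | no _           = refl

  square? : ∀ a → Dec (Square p a)
  square? a with isSquareMod? p a
  ... | yes (x , x²≡a) = yes (+ toℕ x , ≡mod⇒≈ (+ toℕ x * + toℕ x) a x²≡a)
  ... | no ¬sq         = no (¬sq ∘ Square⇒IsSquareMod)

-- Counting square classes; multiplicativity of the Legendre symbol

-- The squares of 1, …, h are distinct mod 1 + 2 h, so each of k distinct square classes has at least
-- h of the 2 h nonzero residues.
square-classes-bound : ∀ h → Prime (ℕ.suc (2 ℕ.* h)) → ∀ {k} (c : Fin k → ℤ) →
  (∀ i → ℕ.suc (2 ℕ.* h) ∤ ∣ c i ∣) →
  (∀ i j x y → ℕ.suc (2 ℕ.* h) ∤ ∣ x ∣ → ℕ.suc (2 ℕ.* h) ∤ ∣ y ∣ →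
    c i * (x * x) ≈ c j * (y * y) ⟨mod ℕ.suc (2 ℕ.* h) ⟩ → i ≡ j) →
  k ℕ.* h ℕ.≤ 2 ℕ.* h
square-classes-bound h pp {k} c p∤c separated = injective⇒≤ {f = value} value-injective
  where
  p = ℕ.suc (2 ℕ.* h)

  class : Fin (k ℕ.* h) → Fin k
  class u = proj₁ (remQuot {k} h u)
  base : Fin (k ℕ.* h) → Fin h
  base u = proj₂ (remQuot {k} h u)
  root : Fin h → ℤ
  root x = + ℕ.suc (toℕ x)
  power : Fin (k ℕ.* h) → ℤ
  power u = c (class u) * (root (base u) * root (base u))

  root+root<p : ∀ x y → ℕ.suc (toℕ x) ℕ.+ ℕ.suc (toℕ y) ℕ.< p
  root+root<p x y = ℕ.s≤s (ℕ.≤-trans (ℕ.+-mono-≤ (toℕ<n x) (toℕ<n y))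
    (ℕ.≤-reflexive (cong (h ℕ.+_) (sym (ℕ.+-identityʳ h)))))

  p∤root : ∀ x → p ∤ ∣ root x ∣
  p∤root x = ℕ.>⇒∤ (ℕ.≤-<-trans (ℕ.m≤m+n _ _) (root+root<p x x))

  p∤power : ∀ u → p ∤ ∣ power u ∣
  p∤power u = ∤-* pp (c (class u)) _ (p∤c (class u))
    (∤-* pp (root (base u)) (root (base u)) (p∤root (base u)) (p∤root (base u)))

  residue≢0 : ∀ u → zero ≢ residue {p} (power u)
  residue≢0 u eq = p∤power u (≈0⇒∣ (≈-trans (residue-≈ (power u)) (≈-reflexive (cong (λ r → + toℕ r) (sym eq)))))

  -- A pair of a class and a base never gives residue 0; removing 0 from the p residues leaves
  -- exactly 2 h targets.
  value : Fin (k ℕ.* h) → Fin (2 ℕ.* h)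
  value u = punchOut (residue≢0 u)

  -- In x² - y² = (x - y)(x + y) both factors are smaller than p in absolute value and x + y is
  -- positive, so p can only divide x - y, which must then be 0.
  root-injective : ∀ x y → root x * root x ≈ root y * root y ⟨mod p ⟩ → x ≡ y
  root-injective x y x²≈y² with euclid pp (root x - root y) (root x + root y)
      (subst (λ z → p ∣ ∣ z ∣) (regroup (root x) (root y)) (≈⇒≡mod x²≈y²))
    where
    regroup : ∀ a b → a * a - b * b ≡ (a - b) * (a + b)
    regroup = solve-∀
  ... | inj₁ p∣x-y = toℕ-injective (ℕ.suc-injective (ℤ.+-injective (ℤ.i-j≡0⇒i≡j (root x) (root y)
    (ℤ.∣i∣≡0⇒i≡0 (∣∧<⇒≡0 p∣x-y (ℕ.≤-<-trans (ℤ.∣i-j∣≤∣i∣+∣j∣ (root x) (root y)) (root+root<p x y)))))))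
  ... | inj₂ p∣x+y = contradiction p∣x+y (ℕ.>⇒∤ (root+root<p x y))

  value-injective : ∀ {u v} → value u ≡ value v → u ≡ v
  value-injective {u} {v} eq = begin
    u                                              ≡⟨ combine-remQuot {k} h u ⟨
    combine (class u) (base u)                     ≡⟨ cong₂ combine class≡ base≡ ⟩
    combine (class v) (base v)                     ≡⟨ combine-remQuot {k} h v ⟩
    v                                              ∎
    where
    open ≡-Reasoning
    power≈ : power u ≈ power v ⟨mod p ⟩
    power≈ = residue-injective (power u) (power v) (punchOut-injective (residue≢0 u) (residue≢0 v) eq)
    class≡ : class u ≡ class v
    class≡ = separated (class u) (class v) (root (base u)) (root (base v)) (p∤root (base u)) (p∤root (base v)) power≈
    base≡ : base u ≡ base v
    base≡ = root-injective (base u) (base v)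
      (cancel pp (c (class v)) _ _ (p∤c (class v))
        (subst (λ i → c i * (root (base u) * root (base u)) ≈ power v ⟨mod p ⟩) class≡ power≈))

odd-prime : ∀ {p} → Prime p → p ≢ 2 → ∃ λ h → p ≡ ℕ.suc (2 ℕ.* h)
odd-prime {p} pp p≢2 with p ℕ.% 2 | m≡m%n+[m/n]*n p 2 | m%n<n p 2
... | 0 | eq | _ with prime⇒irreducible pp (ℕ.divides (p ℕ./ 2) eq)
...   | inj₂ 2≡p = contradiction (sym 2≡p) p≢2
odd-prime {p} pp p≢2 | 1 | eq | _ = p ℕ./ 2 , trans eq (cong ℕ.suc (ℕ.*-comm (p ℕ./ 2) 2))
odd-prime {p} pp p≢2 | ℕ.2+ _ | _ | ℕ.s≤s (ℕ.s≤s ())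

-- If a, b and a b were all nonsquares, then 1, a and a b would lie in three distinct square classes,
-- too many for the 2 h nonzero residues.
nonSquare-* : ∀ {p} → Prime p → p ≢ 2 → ∀ {a b} → p ∤ ∣ a ∣ → p ∤ ∣ b ∣ →
              ¬ Square p a → ¬ Square p b → Square p (a * b)
nonSquare-* pp p≢2 {a} {b} p∤a p∤b ¬□a ¬□b with odd-prime pp p≢2
... | h , refl with square? pp (a * b)
...   | yes □ab = □ab
-- Three classes would give 3 h ≤ 2 h; as p is not 1, h is nonzero and can be cancelled, leaving 3 ≤
-- 2.
...   | no ¬□ab = contradiction (ℕ.*-cancelʳ-≤ 3 2 h {{h≢0}} (square-classes-bound h pp c p∤c separated))
    λ { (ℕ.s≤s (ℕ.s≤s ())) }
  where
  p = ℕ.suc (2 ℕ.* h)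

  h≢0 : ℕ.NonZero h
  h≢0 = ℕ.≢-nonZero λ h≡0 → p∤1 pp (ℕ.∣-reflexive (cong (λ h → ℕ.suc (2 ℕ.* h)) h≡0))

  c : Fin 3 → ℤ
  c zero             = 1ℤ
  c (suc zero)       = a
  c (suc (suc zero)) = a * b

  p∤c : ∀ i → p ∤ ∣ c i ∣
  p∤c zero             = p∤1 pp
  p∤c (suc zero)       = p∤a
  p∤c (suc (suc zero)) = ∤-* pp a b p∤a p∤b

  from-one : ∀ e x y → ¬ Square p e → p ∤ ∣ y ∣ → ¬ 1ℤ * (x * x) ≈ e * (y * y) ⟨mod p ⟩
  from-one e x y ¬□e p∤y eq = ¬□e (square-cancel pp e y p∤y
    (x , ≈-trans (≈-reflexive (sym (ℤ.*-identityˡ (x * x)))) eq))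

  -- Cancelling `a` shows that a common class of `a` and `a * b` would make `b` a square.
  from-a : ∀ x y → p ∤ ∣ y ∣ → ¬ a * (x * x) ≈ a * b * (y * y) ⟨mod p ⟩
  from-a x y p∤y eq = ¬□b (square-cancel pp b y p∤y
    (x , cancel pp a _ _ p∤a (≈-trans eq (≈-reflexive (ℤ.*-assoc a b (y * y))))))

  separated : ∀ i j x y → p ∤ ∣ x ∣ → p ∤ ∣ y ∣ → c i * (x * x) ≈ c j * (y * y) ⟨mod p ⟩ → i ≡ j
  separated zero             zero             _ _ _   _   _  = refl
  separated zero             (suc zero)       x y _   p∤y eq = contradiction eq (from-one a x y ¬□a p∤y)
  separated zero             (suc (suc zero)) x y _   p∤y eq = contradiction eq (from-one (a * b) x y ¬□ab p∤y)
  separated (suc zero)       zero             x y p∤x _   eq = contradiction (≈-sym eq) (from-one a y x ¬□a p∤x)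
  separated (suc zero)       (suc zero)       _ _ _   _   _  = refl
  separated (suc zero)       (suc (suc zero)) x y _   p∤y eq = contradiction eq (from-a x y p∤y)
  separated (suc (suc zero)) zero             x y p∤x _   eq = contradiction (≈-sym eq) (from-one (a * b) y x ¬□ab p∤x)
  separated (suc (suc zero)) (suc zero)       x y p∤x _   eq = contradiction (≈-sym eq) (from-a y x p∤x)
  separated (suc (suc zero)) (suc (suc zero)) _ _ _   _   _  = refl

legendre-* : ∀ {p} → Prime p → p ≢ 2 → ∀ a b → legendre (a * b) p ≡ legendre a p * legendre b p
legendre-* {p} pp p≢2 a b = by-divisibility (p ℕ.∣? ∣ a ∣) (p ℕ.∣? ∣ b ∣)
  where
  -- If c ≈ x² and c d ≈ z², then z² ≈ d x², and x cancels because p does not divide c.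
  quotient-square : ∀ c d → p ∤ ∣ c ∣ → Square p c → Square p (c * d) → Square p d
  quotient-square c d p∤c (x , x²≈c) (z , z²≈cd) = square-cancel pp d x (square-∤ pp c x p∤c x²≈c)
    (z , ≈-trans z²≈cd (≈-trans (≈-reflexive (ℤ.*-comm c d)) (*-congˡ-≈ d (≈-sym x²≈c))))
  square-* : ∀ {c d} → Square p c → Square p d → Square p (c * d)
  square-* (x , x²≈c) (y , y²≈d) = x * y , ≈-trans (≈-reflexive (regroup x y)) (*-cong-≈ x²≈c y²≈d)
    where
    regroup : ∀ x y → x * y * (x * y) ≡ x * x * (y * y)
    regroup = solve-∀
  cases : p ∤ ∣ a ∣ → p ∤ ∣ b ∣ → Dec (Square p a) → Dec (Square p b) →
          legendre (a * b) p ≡ legendre a p * legendre b p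
  cases p∤a p∤b (yes □a) (yes □b) = trans (legendre-square pp (∤-* pp a b p∤a p∤b) (square-* □a □b))
    (sym (cong₂ _*_ (legendre-square pp p∤a □a) (legendre-square pp p∤b □b)))
  cases p∤a p∤b (yes □a) (no ¬□b) = trans (legendre-nonSquare pp (∤-* pp a b p∤a p∤b) (¬□b ∘ quotient-square a b p∤a □a))
    (sym (cong₂ _*_ (legendre-square pp p∤a □a) (legendre-nonSquare pp p∤b ¬□b)))
  cases p∤a p∤b (no ¬□a) (yes □b) = trans (legendre-nonSquare pp (∤-* pp a b p∤a p∤b)
      (¬□a ∘ quotient-square b a p∤b □b ∘ subst (Square p) (ℤ.*-comm a b)))
    (sym (cong₂ _*_ (legendre-nonSquare pp p∤a ¬□a) (legendre-square pp p∤b □b)))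
  cases p∤a p∤b (no ¬□a) (no ¬□b) = trans (legendre-square pp (∤-* pp a b p∤a p∤b) (nonSquare-* pp p≢2 p∤a p∤b ¬□a ¬□b))
    (sym (cong₂ _*_ (legendre-nonSquare pp p∤a ¬□a) (legendre-nonSquare pp p∤b ¬□b)))
  by-divisibility : Dec (p ∣ ∣ a ∣) → Dec (p ∣ ∣ b ∣) → legendre (a * b) p ≡ legendre a p * legendre b p
  by-divisibility (yes p∣a) _ =
    trans (legendre-∣ pp {a * b} (subst (p ∣_) (sym (ℤ.abs-* a b)) (ℕ.∣m⇒∣m*n ∣ b ∣ p∣a)))
      (sym (cong (_* legendre b p) (legendre-∣ pp {a} p∣a)))
  by-divisibility (no _) (yes p∣b) =
    trans (legendre-∣ pp {a * b} (subst (p ∣_) (sym (ℤ.abs-* a b)) (ℕ.∣n⇒∣m*n ∣ a ∣ p∣b)))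
      (sym (trans (cong (_*_ (legendre a p)) (legendre-∣ pp {b} p∣b)) (ℤ.*-zeroʳ (legendre a p))))
  by-divisibility (no p∤a) (no p∤b) = cases p∤a p∤b (square? pp a) (square? pp b)

legendre-unit : ∀ a p → p ∤ ∣ a ∣ → ∣ legendre a p ∣ ≡ 1
legendre-unit a p p∤a with p ℕ.∣? ∣ a ∣ | isSquareMod? p a
... | yes p∣a | _     = contradiction p∣a p∤a
... | no _    | yes _ = refl
... | no _    | no _  = refl

-- The symbol at the prime 2

≈-coarsen : ∀ k {m a b} → a ≈ b ⟨mod k ℕ.* m ⟩ → a ≈ b ⟨mod m ⟩
≈-coarsen k {m} {a} {b} (q by refl) = (q * + k) by
  cong (_+_ b) (trans (cong (q *_) (ℤ.pos-* k m)) (sym (ℤ.*-assoc q (+ k) (+ m))))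

±1-cong : ∀ {a b m} → a ≈ b ⟨mod m ⟩ → a ≡ 1ℤ [mod m ] ⊎ a ≡ -1ℤ [mod m ] →
          b ≡ 1ℤ [mod m ] ⊎ b ≡ -1ℤ [mod m ]
±1-cong {a} a≈b (inj₁ a≡1)  = inj₁ (≈⇒≡mod (≈-trans (≈-sym a≈b) (≡mod⇒≈ a 1ℤ a≡1)))
±1-cong {a} a≈b (inj₂ a≡-1) = inj₂ (≈⇒≡mod (≈-trans (≈-sym a≈b) (≡mod⇒≈ a -1ℤ a≡-1)))

kronecker₂-cong : ∀ {a b} → a ≈ b ⟨mod 8 ⟩ → kronecker₂ a ≡ kronecker₂ b
kronecker₂-cong {a} {b} a≈b with 2 ℕ.∣? ∣ a ∣ | 2 ℕ.∣? ∣ b ∣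
  | ≡mod? a 1ℤ 8 ⊎-dec ≡mod? a -1ℤ 8 | ≡mod? b 1ℤ 8 ⊎-dec ≡mod? b -1ℤ 8
... | yes _   | yes _   | _       | _       = refl
... | yes 2∣a | no 2∤b  | _       | _       =
  contradiction (≈0⇒∣ (≈-trans (≈-sym (≈-coarsen 4 a≈b)) (∣⇒≈0 a 2∣a))) 2∤b
... | no 2∤a  | yes 2∣b | _       | _       =
  contradiction (≈0⇒∣ (≈-trans (≈-coarsen 4 a≈b) (∣⇒≈0 b 2∣b))) 2∤a
... | no _    | no _    | yes _   | yes _   = refl
... | no _    | no _    | no _    | no _    = refl
... | no _    | no _    | yes a≡  | no b≢   = contradiction (±1-cong a≈b a≡) b≢
... | no _    | no _    | no a≢   | yes b≡  = contradiction (±1-cong (≈-sym a≈b) b≡) a≢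

-- Both sides depend only on residues mod 8, which leaves 64 pairs to be decided by computation.
kronecker₂-* : ∀ a b → kronecker₂ (a * b) ≡ kronecker₂ a * kronecker₂ b
kronecker₂-* a b = begin
  kronecker₂ (a * b)
    ≡⟨ kronecker₂-cong (*-cong-≈ (residue-≈ a) (residue-≈ b)) ⟩
  kronecker₂ (+ toℕ r * + toℕ r′)
    ≡⟨ residues r r′ ⟩
  kronecker₂ (+ toℕ r) * kronecker₂ (+ toℕ r′)
    ≡⟨ cong₂ _*_ (kronecker₂-cong (residue-≈ a)) (kronecker₂-cong (residue-≈ b)) ⟨
  kronecker₂ a * kronecker₂ b ∎
  where
  open ≡-Reasoning
  r r′ : Fin 8
  r  = residue a
  r′ = residue b
  residues : ∀ (r r′ : Fin 8) → kronecker₂ (+ toℕ r * + toℕ r′) ≡ kronecker₂ (+ toℕ r) * kronecker₂ (+ toℕ r′)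
  residues = from-yes (all? λ (r : Fin 8) → all? λ (r′ : Fin 8) →
    kronecker₂ (+ toℕ r * + toℕ r′) ℤ.≟ kronecker₂ (+ toℕ r) * kronecker₂ (+ toℕ r′))

kronecker₂-unit : ∀ a → 2 ∤ ∣ a ∣ → ∣ kronecker₂ a ∣ ≡ 1
kronecker₂-unit a 2∤a with 2 ℕ.∣? ∣ a ∣ | ≡mod? a 1ℤ 8 ⊎-dec ≡mod? a -1ℤ 8
... | yes 2∣a | _     = contradiction 2∣a 2∤a
... | no _    | yes _ = refl
... | no _    | no _  = refl

-- The Kronecker symbol for composite lower argument

kroneckerPrime-≢2 : ∀ a p → p ≢ 2 → kroneckerPrime a p ≡ legendre a p
kroneckerPrime-≢2 a 0 _ = refl
kroneckerPrime-≢2 a 1 _ = refl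
kroneckerPrime-≢2 a 2 p≢2 = contradiction refl p≢2
kroneckerPrime-≢2 a (ℕ.suc (ℕ.suc (ℕ.suc _))) _ = refl

kroneckerPrime-* : ∀ {p} → Prime p → ∀ a b → kroneckerPrime (a * b) p ≡ kroneckerPrime a p * kroneckerPrime b p
kroneckerPrime-* {p} pp a b with p ℕ.≟ 2
... | yes refl = kronecker₂-* a b
... | no p≢2
  rewrite kroneckerPrime-≢2 (a * b) p p≢2 | kroneckerPrime-≢2 a p p≢2 | kroneckerPrime-≢2 b p p≢2 =
  legendre-* pp p≢2 a b

kroneckerPrime-unit : ∀ a p → p ∤ ∣ a ∣ → ∣ kroneckerPrime a p ∣ ≡ 1
kroneckerPrime-unit a p p∤a with p ℕ.≟ 2
... | yes refl = kronecker₂-unit a p∤a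
... | no p≢2 rewrite kroneckerPrime-≢2 a p p≢2 = legendre-unit a p p∤a

abs-unit-* : ∀ x y → ∣ x ∣ ≡ 1 → ∣ y ∣ ≡ 1 → ∣ x * y ∣ ≡ 1
abs-unit-* x y ∣x∣≡1 ∣y∣≡1 = trans (ℤ.abs-* x y) (cong₂ ℕ._*_ ∣x∣≡1 ∣y∣≡1)

abs-unit-*⁻ʳ : ∀ x y → ∣ x * y ∣ ≡ 1 → ∣ y ∣ ≡ 1
abs-unit-*⁻ʳ x y ∣xy∣≡1 = ℕ.m*n≡1⇒n≡1 ∣ x ∣ ∣ y ∣ (trans (sym (ℤ.abs-* x y)) ∣xy∣≡1)

kronecker-* : ∀ a b f .{{_ : ℕ.NonZero f}} → kronecker (a * b) f ≡ kronecker a f * kronecker b f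
kronecker-* a b f = go (PrimeFactorisation.factorsPrime (factorise f))
  where
  symbol : ℤ → List ℕ → ℤ
  symbol c ps = foldr _*_ 1ℤ (map (kroneckerPrime c) ps)
  interchange : ∀ u v x y → u * v * (x * y) ≡ u * x * (v * y)
  interchange = solve-∀
  go : ∀ {ps} → All Prime ps → symbol (a * b) ps ≡ symbol a ps * symbol b ps
  go [] = refl
  go {p ∷ ps} (pp ∷ pps) = trans (cong₂ _*_ (kroneckerPrime-* pp a b) (go pps))
    (interchange (kroneckerPrime a p) (kroneckerPrime b p) (symbol a ps) (symbol b ps))

-- A prime of the factorisation dividing `a` would be a common divisor of `a` and `f`, so every
-- local factor is ±1.
kronecker-unit : ∀ a f .{{_ : ℕ.NonZero f}} → Coprime ∣ a ∣ f → ∣ kronecker a f ∣ ≡ 1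
kronecker-unit a f coprime = go (PrimeFactorisation.factorsPrime (factorise f))
  (subst (Coprime ∣ a ∣) (PrimeFactorisation.isFactorisation (factorise f)) coprime)
  where
  go : ∀ {ps} → All Prime ps → Coprime ∣ a ∣ (product ps) → ∣ foldr _*_ 1ℤ (map (kroneckerPrime a) ps) ∣ ≡ 1
  go [] _ = refl
  go {p ∷ ps} (pp ∷ pps) coprime = abs-unit-* (kroneckerPrime a p) _
    (kroneckerPrime-unit a p λ p∣a → p∤1 pp (ℕ.∣-reflexive (coprime (p∣a , ℕ.m∣m*n (product ps)))))
    (go pps λ (d∣a , d∣ps) → coprime (d∣a , ℕ.∣n⇒∣m*n p d∣ps))

-- Symmetric differences and products over subsets

_△_ : ∀ {n} → Subset n → Subset n → Subset n
_△_ = zipWith _xor_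

-- Translation by `U` is an involution, so membership of a translate can be carried back to the
-- original set.
△-cancelʳ : ∀ {n} (T U : Subset n) → (T △ U) △ U ≡ T
△-cancelʳ [] [] = refl
△-cancelʳ (inside  ∷ T) (inside  ∷ U) = cong (inside ∷_) (△-cancelʳ T U)
△-cancelʳ (inside  ∷ T) (outside ∷ U) = cong (inside ∷_) (△-cancelʳ T U)
△-cancelʳ (outside ∷ T) (inside  ∷ U) = cong (outside ∷_) (△-cancelʳ T U)
△-cancelʳ (outside ∷ T) (outside ∷ U) = cong (outside ∷_) (△-cancelʳ T U)

-- Elements common to T and U occur twice on the left and drop out of `T △ U`; the square collects
-- them.
∏-△ : ∀ {n} (T U : Subset n) (g : Fin n → ℤ) → ∏ T g * ∏ U g ≡ ∏ (T △ U) g * (∏ (T ∩ U) g * ∏ (T ∩ U) g)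
∏-△ [] [] g = refl
∏-△ (inside ∷ T) (inside ∷ U) g =
  trans (regroup₁ a t u) (trans (cong (_*_ (a * a)) (∏-△ T U (g ∘ suc))) (regroup₂ a d i))
  where
  a = g zero
  t = ∏ T (g ∘ suc)
  u = ∏ U (g ∘ suc)
  d = ∏ (T △ U) (g ∘ suc)
  i = ∏ (T ∩ U) (g ∘ suc)
  regroup₁ : ∀ a t u → a * t * (a * u) ≡ a * a * (t * u)
  regroup₁ = solve-∀
  regroup₂ : ∀ a d i → a * a * (d * (i * i)) ≡ d * (a * i * (a * i))
  regroup₂ = solve-∀
∏-△ (inside ∷ T) (outside ∷ U) g =
  trans (ℤ.*-assoc (g zero) (∏ T _) (∏ U _)) (trans (cong (_*_ (g zero)) (∏-△ T U (g ∘ suc)))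
    (sym (ℤ.*-assoc (g zero) (∏ (T △ U) _) (∏ (T ∩ U) _ * ∏ (T ∩ U) _))))
∏-△ (outside ∷ T) (inside ∷ U) g =
  trans (regroup (g zero) (∏ T _) (∏ U _)) (trans (cong (_*_ (g zero)) (∏-△ T U (g ∘ suc)))
    (sym (ℤ.*-assoc (g zero) (∏ (T △ U) _) (∏ (T ∩ U) _ * ∏ (T ∩ U) _))))
  where
  regroup : ∀ a t u → t * (a * u) ≡ a * (t * u)
  regroup = solve-∀
∏-△ (outside ∷ T) (outside ∷ U) g = ∏-△ T U (g ∘ suc)

∏-unit : ∀ {n} (T : Subset n) {g : Fin n → ℤ} → (∀ i → ∣ g i ∣ ≡ 1) → ∣ ∏ T g ∣ ≡ 1
∏-unit []            _      = refl
∏-unit (inside  ∷ T) {g} g-unit = abs-unit-* (g zero) (∏ T (g ∘ suc)) (g-unit zero) (∏-unit T (g-unit ∘ suc))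
∏-unit (outside ∷ T) g-unit = ∏-unit T (g-unit ∘ suc)

∏-⊥ : ∀ n (g : Fin n → ℤ) → ∏ ⊥ g ≡ 1ℤ
∏-⊥ ℕ.zero    g = refl
∏-⊥ (ℕ.suc n) g = ∏-⊥ n (g ∘ suc)

-- Sums over subsets and characters with values ±1

sum : List ℤ → ℤ
sum = foldr _+_ 0ℤ

sum-++ : ∀ xs ys → sum (xs ++ ys) ≡ sum xs + sum ys
sum-++ []       ys = sym (ℤ.+-identityˡ (sum ys))
sum-++ (x ∷ xs) ys = trans (cong (_+_ x) (sum-++ xs ys)) (sym (ℤ.+-assoc x (sum xs) (sum ys)))

sum-neg : ∀ {A : Set} (h : A → ℤ) xs → sum (map (-_ ∘ h) xs) ≡ - sum (map h xs)
sum-neg h []       = refl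
sum-neg h (x ∷ xs) = trans (cong (_+_ (- h x)) (sum-neg h xs)) (sym (ℤ.neg-distrib-+ (h x) _))

sum-nonNeg : ∀ {A : Set} {h : A → ℤ} → (∀ x → 0ℤ ≤ h x) → ∀ xs → 0ℤ ≤ sum (map h xs)
sum-nonNeg 0≤h []       = ℤ.≤-refl
sum-nonNeg 0≤h (x ∷ xs) = ℤ.+-mono-≤ (0≤h x) (sum-nonNeg 0≤h xs)

sum-pos : ∀ {A : Set} {h : A → ℤ} → (∀ x → 0ℤ ≤ h x) → ∀ {x xs} → x ∈ xs → 0ℤ < h x → 0ℤ < sum (map h xs)
sum-pos 0≤h {xs = _ ∷ xs} (here refl) 0<hx = ℤ.+-mono-<-≤ 0<hx (sum-nonNeg 0≤h xs)
sum-pos 0≤h {xs = y ∷ _}  (there x∈)  0<hx = ℤ.+-mono-≤-< (0≤h y) (sum-pos 0≤h x∈ 0<hx)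

∈-subsets : ∀ {n} (T : Subset n) → T ∈ subsets n
∈-subsets []            = here refl
∈-subsets (inside  ∷ T) = ∈-++⁺ˡ (∈-map⁺ (inside ∷_) (∈-subsets T))
∈-subsets (outside ∷ T) = ∈-++⁺ʳ _ (∈-map⁺ (outside ∷_) (∈-subsets T))

sum-subsets-suc : ∀ n (h : Subset (ℕ.suc n) → ℤ) → sum (map h (subsets (ℕ.suc n))) ≡
  sum (map (h ∘ (inside ∷_)) (subsets n)) + sum (map (h ∘ (outside ∷_)) (subsets n))
sum-subsets-suc n h = begin
  sum (map h (map (inside ∷_) (subsets n) ++ map (outside ∷_) (subsets n)))
    ≡⟨ cong sum (List.map-++ h (map (inside ∷_) (subsets n)) _) ⟩
  sum (map h (map (inside ∷_) (subsets n)) ++ map h (map (outside ∷_) (subsets n)))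
    ≡⟨ sum-++ (map h (map (inside ∷_) (subsets n))) _ ⟩
  sum (map h (map (inside ∷_) (subsets n))) + sum (map h (map (outside ∷_) (subsets n)))
    ≡⟨ cong₂ (λ xs ys → sum xs + sum ys) (List.map-∘ (subsets n)) (List.map-∘ (subsets n)) ⟨
  sum (map (h ∘ (inside ∷_)) (subsets n)) + sum (map (h ∘ (outside ∷_)) (subsets n)) ∎
  where open ≡-Reasoning

-- An `inside` head of the translating set swaps the two halves of `subsets (suc n)`, an `outside`
-- head keeps each in place.
sum-translate : ∀ {n} (U : Subset n) (h : Subset n → ℤ) →
                sum (map h (subsets n)) ≡ sum (map (λ T → h (T △ U)) (subsets n))
sum-translate [] h = refl
sum-translate {ℕ.suc n} (inside ∷ U) h = begin
  sum (map h (subsets (ℕ.suc n)))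
    ≡⟨ sum-subsets-suc n h ⟩
  sum (map (h ∘ (inside ∷_)) (subsets n)) + sum (map (h ∘ (outside ∷_)) (subsets n))
    ≡⟨ ℤ.+-comm (sum (map (h ∘ (inside ∷_)) (subsets n))) _ ⟩
  sum (map (h ∘ (outside ∷_)) (subsets n)) + sum (map (h ∘ (inside ∷_)) (subsets n))
    ≡⟨ cong₂ _+_ (sum-translate U (h ∘ (outside ∷_))) (sum-translate U (h ∘ (inside ∷_))) ⟩
  sum (map (λ T → h (outside ∷ (T △ U))) (subsets n)) + sum (map (λ T → h (inside ∷ (T △ U))) (subsets n))
    ≡⟨ sum-subsets-suc n (λ T → h (T △ (inside ∷ U))) ⟨
  sum (map (λ T → h (T △ (inside ∷ U))) (subsets (ℕ.suc n))) ∎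
  where open ≡-Reasoning
sum-translate {ℕ.suc n} (outside ∷ U) h = begin
  sum (map h (subsets (ℕ.suc n)))
    ≡⟨ sum-subsets-suc n h ⟩
  sum (map (h ∘ (inside ∷_)) (subsets n)) + sum (map (h ∘ (outside ∷_)) (subsets n))
    ≡⟨ cong₂ _+_ (sum-translate U (h ∘ (inside ∷_))) (sum-translate U (h ∘ (outside ∷_))) ⟩
  sum (map (λ T → h (inside ∷ (T △ U))) (subsets n)) + sum (map (λ T → h (outside ∷ (T △ U))) (subsets n))
    ≡⟨ sum-subsets-suc n (λ T → h (T △ (outside ∷ U))) ⟨
  sum (map (λ T → h (T △ (outside ∷ U))) (subsets (ℕ.suc n))) ∎
  where open ≡-Reasoning

-- Extension by zero turns a sum over P into one over all subsets, where `sum-translate` applies.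
restrict : ∀ {n} {P : Pred (Subset n) 0ℓ} → Decidable P → (Subset n → ℤ) → Subset n → ℤ
restrict P? g T = if does (P? T) then g T else 0ℤ

sum-filter : ∀ {n} {P : Pred (Subset n) 0ℓ} (P? : Decidable P) g xs →
             sum (map g (filter P? xs)) ≡ sum (map (restrict P? g) xs)
sum-filter P? g [] = refl
sum-filter P? g (T ∷ xs) with P? T
... | yes _ = cong (_+_ (g T)) (sum-filter P? g xs)
... | no _  = trans (sum-filter P? g xs) (sym (ℤ.+-identityˡ _))

≡-neg⇒≡0 : ∀ i → i ≡ - i → i ≡ 0ℤ
≡-neg⇒≡0 (+ ℕ.zero) _ = refl

unit-cases : ∀ i → ∣ i ∣ ≡ 1 → i ≡ 1ℤ ⊎ i ≡ -1ℤ
unit-cases (+ _)    refl = inj₁ refl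
unit-cases -[1+ _ ] refl = inj₂ refl

unit-square : ∀ i → ∣ i ∣ ≡ 1 → i * i ≡ 1ℤ
unit-square (+ _)    refl = refl
unit-square -[1+ _ ] refl = refl

-- Translation by some U with g U = -1 negates the sum.
character-sum : ∀ {n} {P : Pred (Subset n) 0ℓ} (P? : Decidable P) (g : Subset n → ℤ) →
  (∃ P) → (∀ T U → P T → P U → P (T △ U)) →
  (∀ T → P T → ∣ g T ∣ ≡ 1) → (∀ T U → P T → P U → g (T △ U) ≡ g T * g U) →
  0ℤ ≤ ∑ P? g × (0ℤ < ∑ P? g ⇔ (∀ T → P T → g T ≡ 1ℤ))
character-sum {n} {P} P? g (T₀ , PT₀) P-△ g-unit g-△ rewrite sum-filter P? g (subsets n) =
  [ ℤ.≤-reflexive ∘ sym , ℤ.<⇒≤ ∘ positive ]′ dichotomy ,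
  mk⇔ trivial-if-positive positive
  where
  h = restrict P? g
  S = sum (map h (subsets n))

  positive : (∀ T → P T → g T ≡ 1ℤ) → 0ℤ < S
  -- Every term is 0 or 1, and the term at `T₀` is 1.
  positive g≡1 = sum-pos 0≤h (∈-subsets T₀) 0<hT₀
    where
    0≤h : ∀ T → 0ℤ ≤ h T
    0≤h T with P? T
    ... | yes PT = ℤ.≤-trans (+≤+ ℕ.z≤n) (ℤ.≤-reflexive (sym (g≡1 T PT)))
    ... | no _   = ℤ.≤-refl
    0<hT₀ : 0ℤ < h T₀
    0<hT₀ with P? T₀
    ... | yes _   = subst (0ℤ <_) (sym (g≡1 T₀ PT₀)) (+<+ ℕ.z<s)
    ... | no ¬PT₀ = contradiction PT₀ ¬PT₀

  vanishes : ∀ U → P U → g U ≡ -1ℤ → S ≡ 0ℤ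
  vanishes U PU gU≡-1 = ≡-neg⇒≡0 S (begin
    S                                        ≡⟨ sum-translate U h ⟩
    sum (map (λ T → h (T △ U)) (subsets n))  ≡⟨ cong sum (List.map-cong negated (subsets n)) ⟩
    sum (map (-_ ∘ h) (subsets n))           ≡⟨ sum-neg h (subsets n) ⟩
    - S                                      ∎)
    where
    open ≡-Reasoning
    negated : ∀ T → h (T △ U) ≡ - h T
    negated T with P? T | P? (T △ U)
    ... | yes PT | yes _     = trans (g-△ T U PT PU) 
      (trans (cong (g T *_) gU≡-1) (trans (ℤ.*-comm (g T) -1ℤ) (ℤ.-1*i≡-i (g T))))
    ... | yes PT | no ¬PT△U  = contradiction (P-△ T U PT PU) ¬PT△U
    -- Translating `T △ U` by `U` once more would put T itself into P.
    ... | no ¬PT | yes PT△U  = contradiction (subst P (△-cancelʳ T U) (P-△ (T △ U) U PT△U PU)) ¬PT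
    ... | no _   | no _      = refl

  dichotomy : S ≡ 0ℤ ⊎ (∀ T → P T → g T ≡ 1ℤ)
  -- A finite search decides whether the value -1 occurs on P; if not, all values there are 1.
  dichotomy with anySubset? (λ U → P? U ×-dec (g U ℤ.≟ -1ℤ))
  ... | yes (U , PU , gU≡-1) = inj₁ (vanishes U PU gU≡-1)
  ... | no ¬∃ = inj₂ λ T PT →
    [ id , (λ eq → contradiction (T , PT , eq) ¬∃) ]′ (unit-cases (g T) (g-unit T PT))

  trivial-if-positive : 0ℤ < S → ∀ T → P T → g T ≡ 1ℤ
  trivial-if-positive 0<S = [ (λ S≡0 → contradiction (sym S≡0) (ℤ.<⇒≢ 0<S)) , id ]′ dichotomy

-- Squarefree parts of products

-- With g = gcd a d and a = a′ g, the cofactor a′ divides g, so a′² ∣ a.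
squarefree-∣-square : ∀ {a d} → Squarefreeℕ a → a ∣ d ℕ.* d → a ∣ d
-- Zero is not squarefree, being divisible by 2 * 2.
squarefree-∣-square {ℕ.zero}        sf _    = contradiction (sf 2 (4 ℕ.∣0)) λ ()
squarefree-∣-square {a@(ℕ.suc _)} {d} sf a∣d² = subst (_∣ d) (sym a≡g) (gcd[m,n]∣n a d)
  where
  g = gcd a d
  instance
    g≢0 : ℕ.NonZero g
    g≢0 = ℕ.≢-nonZero (gcd[m,n]≢0 a d (inj₁ λ ()))
  a′ = a ℕ./ g
  d′ = d ℕ./ g
  a′g≡a : a′ ℕ.* g ≡ a
  a′g≡a = m/n*n≡m (gcd[m,n]∣m a d)
  coprime : Coprime a′ d′
  coprime = Coprimality.coprime-/gcd a d
  regroup : ∀ d g → (d ℕ.* g) ℕ.* (d ℕ.* g) ≡ (d ℕ.* (d ℕ.* g)) ℕ.* g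
  regroup = ℕSolver.solve-∀
  -- Cancelling one g from a ∣ d² leaves a′ ∣ d′ (d′ g), and a′ is prime to d′, so both factors d′
  -- can be stripped.
  a′∣g : a′ ∣ g
  a′∣g = coprime-divisor coprime (coprime-divisor coprime (ℕ.*-cancelʳ-∣ g
    (subst₂ _∣_ (sym a′g≡a) (trans (cong (λ x → x ℕ.* x) (sym (m/n*n≡m (gcd[m,n]∣n a d)))) (regroup d′ g)) a∣d²)))
  a≡g : a ≡ g
  a≡g = trans (sym a′g≡a) (trans (cong (ℕ._* g)
    (sf a′ (subst (a′ ℕ.* a′ ∣_) a′g≡a (ℕ.*-monoʳ-∣ a′ a′∣g)))) (ℕ.*-identityˡ g))

sqf-squarefree : ∀ n .{{_ : NonZero n}} → Squarefree (sqf n)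
sqf-squarefree n = SquarefreeDecomposition.squarefree (decompose n)

nonZero-factorˡ : ∀ a b → NonZero (a * b) → NonZero a
nonZero-factorˡ a b ab≢0 = ℕ.m*n≢0⇒m≢0 ∣ a ∣ {{subst ℕ.NonZero (ℤ.abs-* a b) ab≢0}}

sqf-nonZero : ∀ n {{_ : NonZero n}} → NonZero (sqf n)
sqf-nonZero n {{n≢0}} = nonZero-factorˡ part (root * root) (subst NonZero equation n≢0)
  where open SquarefreeDecomposition (decompose n)

-- x y = u (v m k)² = a (r w)², and the squarefree part of x y is unique, so u = a.
squarefree-part-* : ∀ {x y z w} {{_ : NonZero (x * y)}} → x * y ≡ z * (w * w) →
  (X : SquarefreeDecomposition x) (Y : SquarefreeDecomposition y) (Z : SquarefreeDecomposition z) →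
  let open SquarefreeDecomposition in
  SquarefreeDecomposition (part X * part Y) → ∃ λ v → part X * part Y ≡ part Z * (v * v)
squarefree-part-* {x} {y} {z} {w} xy≡zw²
  record { part = s ; root = m ; equation = x≡sm² }
  record { part = t ; root = k ; equation = y≡tk² }
  record { part = a ; root = r ; squarefree = a-sf ; equation = z≡ar² }
  record { part = u ; root = v ; squarefree = u-sf ; equation = st≡uv² } =
  v , trans st≡uv² (cong (_* (v * v)) u≡a)
  where
  regroup₁ : ∀ s m t k → s * (m * m) * (t * (k * k)) ≡ s * t * (m * k * (m * k))
  regroup₁ = solve-∀
  regroup₂ : ∀ s m k → s * (m * m) * (k * k) ≡ s * (m * k * (m * k))
  regroup₂ = solve-∀
  xy≡u : x * y ≡ u * (v * (m * k) * (v * (m * k)))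
  xy≡u = begin
    x * y                                ≡⟨ cong₂ _*_ x≡sm² y≡tk² ⟩
    s * (m * m) * (t * (k * k))          ≡⟨ regroup₁ s m t k ⟩
    s * t * (m * k * (m * k))            ≡⟨ cong (_* (m * k * (m * k))) st≡uv² ⟩
    u * (v * v) * (m * k * (m * k))      ≡⟨ regroup₂ u v (m * k) ⟩
    u * (v * (m * k) * (v * (m * k)))    ∎
    where open ≡-Reasoning
  xy≡a : x * y ≡ a * (r * w * (r * w))
  xy≡a = trans xy≡zw² (trans (cong (_* (w * w)) z≡ar²) (regroup₂ a r w))
  u≡a : u ≡ a
  u≡a = trans (sqf-unique {x * y} {u} {v * (m * k)} u-sf xy≡u) (sym (sqf-unique {x * y} {a} {r * w} a-sf xy≡a))

-- The witness is the root in the decomposition of `sqf x * sqf y` itself, so no quotient of the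
-- roots of x, y and z has to be formed.
sqf-* : ∀ x y z w {{_ : NonZero x}} {{_ : NonZero y}} {{_ : NonZero z}} →
        x * y ≡ z * (w * w) → ∃ λ v → sqf x * sqf y ≡ sqf z * (v * v)
sqf-* x y z w xy≡zw² = squarefree-part-* {x} {y} {z} {w} {{ℤ.i*j≢0 x y}} xy≡zw² (decompose x) (decompose y) (decompose z)
  (decompose (sqf x * sqf y) {{ℤ.i*j≢0 (sqf x) (sqf y) {{sqf-nonZero x}} {{sqf-nonZero y}}}})

sqf-1 : ∀ n {{_ : NonZero n}} → n ≡ 1ℤ → sqf n ≡ 1ℤ
sqf-1 n n≡1 = sym (sqf-unique {n} {1ℤ} {1ℤ} (λ k k²∣1 → ℕ.m*n≡1⇒m≡1 k k (ℕ.∣1⇒≡1 k²∣1)) n≡1)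

-- `a` divides `s * t`, which divides d², and squarefreeness lowers d² to d.
part-∣ : ∀ s t a v {d} → Squarefree a → s * t ≡ a * (v * v) → ∣ s ∣ ∣ d → ∣ t ∣ ∣ d → ∣ a ∣ ∣ d
part-∣ s t a v a-sf st≡av² s∣d t∣d = squarefree-∣-square a-sf
  (ℕ.∣-trans (ℕ.∣-trans (ℕ.m∣m*n ∣ v * v ∣) (ℕ.∣-reflexive abs-eq)) (ℕ.*-pres-∣ s∣d t∣d))
  where
  abs-eq : ∣ a ∣ ℕ.* ∣ v * v ∣ ≡ ∣ s ∣ ℕ.* ∣ t ∣
  abs-eq = trans (sym (ℤ.abs-* a (v * v))) (trans (cong ∣_∣ (sym st≡av²)) (ℤ.abs-* s t))

-- In K(s) K(t) = K(a) K(v)² the left side is ±1, so K(v) is ±1 and its square is 1. The coprimality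
-- of v and f never has to be established.
kronecker-part : ∀ s t a v f .{{_ : ℕ.NonZero f}} → s * t ≡ a * (v * v) →
  ∣ kronecker s f ∣ ≡ 1 → ∣ kronecker t f ∣ ≡ 1 → kronecker a f ≡ kronecker s f * kronecker t f
kronecker-part s t a v f st≡av² s-unit t-unit = begin
  K a                ≡⟨ ℤ.*-identityʳ (K a) ⟨
  K a * 1ℤ           ≡⟨ cong (_*_ (K a)) (unit-square (K v) Kv-unit) ⟨
  K a * (K v * K v)  ≡⟨ K-eq ⟨
  K s * K t          ∎
  where
  open ≡-Reasoning
  K : ℤ → ℤ
  K a = kronecker a f
  K-eq : K s * K t ≡ K a * (K v * K v)
  K-eq = begin
    K s * K t          ≡⟨ kronecker-* s t f ⟨
    K (s * t)          ≡⟨ cong K st≡av² ⟩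
    K (a * (v * v))    ≡⟨ kronecker-* a (v * v) f ⟩
    K a * K (v * v)    ≡⟨ cong (_*_ (K a)) (kronecker-* v v f) ⟩
    K a * (K v * K v)  ∎
  Kv-unit : ∣ K v ∣ ≡ 1
  Kv-unit = abs-unit-*⁻ʳ (K v) (K v) (abs-unit-*⁻ʳ (K a) (K v * K v)
    (trans (cong ∣_∣ (sym K-eq)) (abs-unit-* (K s) (K t) s-unit t-unit)))

-- Squarefree parts modulo 4

square-mod-4 : ∀ v → v * v ≈ 0ℤ ⟨mod 4 ⟩ ⊎ v * v ≈ 1ℤ ⟨mod 4 ⟩
square-mod-4 v with residues (residue v)
  where
  residues : ∀ (r : Fin 4) → (+ toℕ r * + toℕ r ≡ 0ℤ [mod 4 ]) ⊎ (+ toℕ r * + toℕ r ≡ 1ℤ [mod 4 ])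
  residues = from-yes (all? λ (r : Fin 4) → ≡mod? (+ toℕ r * + toℕ r) 0ℤ 4 ⊎-dec ≡mod? (+ toℕ r * + toℕ r) 1ℤ 4)
... | inj₁ r²≡0 = inj₁ (≈-trans (*-cong-≈ (residue-≈ v) (residue-≈ v)) (≡mod⇒≈ _ 0ℤ r²≡0))
... | inj₂ r²≡1 = inj₂ (≈-trans (*-cong-≈ (residue-≈ v) (residue-≈ v)) (≡mod⇒≈ _ 1ℤ r²≡1))

-- A square is 0 or 1 mod 4, and v² ≡ 0 would give e ≡ 0.
part-mod-4 : ∀ s t a v b c e → s * t ≡ a * (v * v) → ¬ e ≡ 0ℤ [mod 4 ] → b * c ≡ e [mod 4 ] →
             s ≡ b [mod 4 ] → t ≡ c [mod 4 ] → a ≡ e [mod 4 ]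
part-mod-4 s t a v b c e st≡av² e≢0 bc≡e s≡b t≡c = ≈⇒≡mod ([ v²≈0-case , v²≈1-case ]′ (square-mod-4 v))
  where
  av²≈e : a * (v * v) ≈ e ⟨mod 4 ⟩
  av²≈e = ≈-trans (≈-reflexive (sym st≡av²))
    (≈-trans (*-cong-≈ (≡mod⇒≈ s b s≡b) (≡mod⇒≈ t c t≡c)) (≡mod⇒≈ (b * c) e bc≡e))
  v²≈0-case : v * v ≈ 0ℤ ⟨mod 4 ⟩ → a ≈ e ⟨mod 4 ⟩
  v²≈0-case v²≈0 = contradiction (≈⇒≡mod (≈-trans (≈-sym av²≈e)
    (≈-trans (*-congˡ-≈ a v²≈0) (≈-reflexive (ℤ.*-zeroʳ a))))) e≢0
  v²≈1-case : v * v ≈ 1ℤ ⟨mod 4 ⟩ → a ≈ e ⟨mod 4 ⟩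
  v²≈1-case v²≈1 = ≈-trans (≈-reflexive (sym (ℤ.*-identityʳ a))) (≈-trans (*-congˡ-≈ a (≈-sym v²≈1)) av²≈e)

part-odd : ∀ s t a v → s * t ≡ a * (v * v) →
  (s ≡ 1ℤ [mod 4 ]) ⊎ (s ≡ + 3 [mod 4 ]) → (t ≡ 1ℤ [mod 4 ]) ⊎ (t ≡ + 3 [mod 4 ]) →
  (a ≡ 1ℤ [mod 4 ]) ⊎ (a ≡ + 3 [mod 4 ])
part-odd s t a v eq = λ where
    (inj₁ s≡1) (inj₁ t≡1) → inj₁ (part-mod-4 s t a v 1ℤ 1ℤ 1ℤ eq 1≢0 (4 ℕ.∣0) s≡1 t≡1)
    (inj₁ s≡1) (inj₂ t≡3) → inj₂ (part-mod-4 s t a v 1ℤ (+ 3) (+ 3) eq 3≢0 (4 ℕ.∣0) s≡1 t≡3)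
    (inj₂ s≡3) (inj₁ t≡1) → inj₂ (part-mod-4 s t a v (+ 3) 1ℤ (+ 3) eq 3≢0 (4 ℕ.∣0) s≡3 t≡1)
    -- Here 3 * 3 - 1 = 2 * 4; in the other cases the product equals the target residue and the
    -- difference is 0.
    (inj₂ s≡3) (inj₂ t≡3) → inj₁ (part-mod-4 s t a v (+ 3) (+ 3) 1ℤ eq 1≢0 (ℕ.divides 2 refl) s≡3 t≡3)
  where
  1≢0 = from-no (≡mod? 1ℤ 0ℤ 4)
  3≢0 = from-no (≡mod? (+ 3) 0ℤ 4)

-- The groups 𝒟ᵢ and the character on them

module _ (S : NonZeroIntegers) where
  open NonZeroIntegers S

  private
    ∏≢0 : ∀ T → NonZero (∏ T element)
    ∏≢0 T = ∏-nonZero T nonZero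

  sqfSet-△ : ∀ T U → ∃ λ v → sqfSet S T * sqfSet S U ≡ sqfSet S (T △ U) * (v * v)
  sqfSet-△ T U = sqf-* (∏ T element) (∏ U element) (∏ (T △ U) element) (∏ (T ∩ U) element)
    {{∏≢0 T}} {{∏≢0 U}} {{∏≢0 (T △ U)}} (∏-△ T U element)

  sqfSet-⊥ : sqfSet S ⊥ ≡ 1ℤ
  sqfSet-⊥ = sqf-1 (∏ ⊥ element) {{∏≢0 ⊥}} (∏-⊥ size element)

  𝒟₀-⊥ : ∀ d → 𝒟₀ S d ⊥
  𝒟₀-⊥ d = subst (λ s → ∣ s ∣ ∣ d) (sym sqfSet-⊥) (ℕ.1∣ d)

  𝒟₂-⊥ : ∀ d → 𝒟₂ S d ⊥
  𝒟₂-⊥ d = 𝒟₀-⊥ d , subst (λ s → s ≡ 1ℤ [mod 4 ]) (sym sqfSet-⊥) (4 ℕ.∣0)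

  𝒟₁-⊥ : ∀ d → 𝒟₁ S d ⊥
  𝒟₁-⊥ d = 𝒟₀-⊥ d , inj₁ (proj₂ (𝒟₂-⊥ d))

  𝒟₀-△ : ∀ d T U → 𝒟₀ S d T → 𝒟₀ S d U → 𝒟₀ S d (T △ U)
  𝒟₀-△ d T U = part-∣ (sqfSet S T) (sqfSet S U) (sqfSet S (T △ U)) (proj₁ (sqfSet-△ T U))
    (sqf-squarefree (∏ (T △ U) element) {{∏≢0 (T △ U)}}) (proj₂ (sqfSet-△ T U))

  𝒟₁-△ : ∀ d T U → 𝒟₁ S d T → 𝒟₁ S d U → 𝒟₁ S d (T △ U)
  𝒟₁-△ d T U (T∈ , s-odd) (U∈ , t-odd) = 𝒟₀-△ d T U T∈ U∈ ,
    part-odd (sqfSet S T) (sqfSet S U) (sqfSet S (T △ U)) (proj₁ (sqfSet-△ T U)) (proj₂ (sqfSet-△ T U)) s-odd t-odd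

  𝒟₂-△ : ∀ d T U → 𝒟₂ S d T → 𝒟₂ S d U → 𝒟₂ S d (T △ U)
  𝒟₂-△ d T U (T∈ , s≡1) (U∈ , t≡1) = 𝒟₀-△ d T U T∈ U∈ ,
    part-mod-4 (sqfSet S T) (sqfSet S U) (sqfSet S (T △ U)) (proj₁ (sqfSet-△ T U)) 1ℤ 1ℤ 1ℤ (proj₂ (sqfSet-△ T U))
      (from-no (≡mod? 1ℤ 0ℤ 4)) (4 ℕ.∣0) s≡1 t≡1

  signSet-unit : ∀ θ T → ∣ signSet S θ T ∣ ≡ 1
  signSet-unit θ T = ∏-unit T (λ i → ℤ.abs-◃ (θ i) 1)

  module _ (θ : Fin size → Sign) (f d : ℕ) .{{_ : ℕ.NonZero f}} (f⊥d : Coprime f d) where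

    χ : Subset size → ℤ
    χ T = kronecker (sqfSet S T) f * signSet S θ T

    -- The coprimality of f and d enters here: a common divisor of sqf(T) and f also divides d.
    kronecker-sqfSet-unit : ∀ T → 𝒟₀ S d T → ∣ kronecker (sqfSet S T) f ∣ ≡ 1
    kronecker-sqfSet-unit T T∈ = kronecker-unit (sqfSet S T) f λ (e∣s , e∣f) → f⊥d (e∣f , ℕ.∣-trans e∣s T∈)

    χ-unit : ∀ T → 𝒟₀ S d T → ∣ χ T ∣ ≡ 1
    χ-unit T T∈ = abs-unit-* (kronecker (sqfSet S T) f) (signSet S θ T) (kronecker-sqfSet-unit T T∈) (signSet-unit θ T)

    kronecker-sqfSet-△ : ∀ T U → 𝒟₀ S d T → 𝒟₀ S d U →
      kronecker (sqfSet S (T △ U)) f ≡ kronecker (sqfSet S T) f * kronecker (sqfSet S U) f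
    kronecker-sqfSet-△ T U T∈ U∈ =
      kronecker-part (sqfSet S T) (sqfSet S U) (sqfSet S (T △ U)) (proj₁ (sqfSet-△ T U)) f (proj₂ (sqfSet-△ T U))
        (kronecker-sqfSet-unit T T∈) (kronecker-sqfSet-unit U U∈)

    -- The common elements contribute the square of a sign, which is 1.
    signSet-△ : ∀ T U → signSet S θ (T △ U) ≡ signSet S θ T * signSet S θ U
    signSet-△ T U = begin
      ϑ (T △ U)                              ≡⟨ ℤ.*-identityʳ (ϑ (T △ U)) ⟨
      ϑ (T △ U) * 1ℤ                         ≡⟨ cong (_*_ (ϑ (T △ U))) (unit-square (ϑ (T ∩ U)) (signSet-unit θ (T ∩ U))) ⟨
      ϑ (T △ U) * (ϑ (T ∩ U) * ϑ (T ∩ U))    ≡⟨ ∏-△ T U (λ i → θ i ◃ 1) ⟨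
      ϑ T * ϑ U                              ∎
      where
      open ≡-Reasoning
      ϑ = signSet S θ

    χ-△ : ∀ T U → 𝒟₀ S d T → 𝒟₀ S d U → χ (T △ U) ≡ χ T * χ U
    χ-△ T U T∈ U∈ = trans (cong₂ _*_ (kronecker-sqfSet-△ T U T∈ U∈) (signSet-△ T U))
      (interchange (kronecker (sqfSet S T) f) (kronecker (sqfSet S U) f) (signSet S θ T) (signSet S θ U))
      where
      interchange : ∀ k l m n → k * l * (m * n) ≡ k * m * (l * n)
      interchange = solve-∀

    -- The symbol is ±1 on 𝒟₀, hence its own inverse, and can be moved across the equation.
    χ≡1⇔ : ∀ T → 𝒟₀ S d T → χ T ≡ 1ℤ ⇔ signSet S θ T ≡ kronecker (sqfSet S T) f
    χ≡1⇔ T T∈ = mk⇔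
      (λ χ≡1 → begin
        signSet S θ T                   ≡⟨ ℤ.*-identityˡ (signSet S θ T) ⟨
        1ℤ * signSet S θ T              ≡⟨ cong (_* signSet S θ T) k²≡1 ⟨
        k * k * signSet S θ T           ≡⟨ ℤ.*-assoc k k (signSet S θ T) ⟩
        k * χ T                         ≡⟨ cong (_*_ k) χ≡1 ⟩
        k * 1ℤ                          ≡⟨ ℤ.*-identityʳ k ⟩
        k                               ∎)
      (λ θ≡k → trans (cong (_*_ k) θ≡k) k²≡1)
      where
      open ≡-Reasoning
      k = kronecker (sqfSet S T) f
      k²≡1 : k * k ≡ 1ℤ
      k²≡1 = unit-square k (kronecker-sqfSet-unit T T∈)

    -- One argument serves all three index sets: each lies in 𝒟₀, where the facts about `χ` hold.
    χ-sum : ∀ {P : Pred (Subset size) 0ℓ} (P? : Decidable P) → P ⊥ → (∀ T U → P T → P U → P (T △ U)) →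
      (∀ T → P T → 𝒟₀ S d T) →
      0ℤ ≤ ∑ P? χ × (0ℤ < ∑ P? χ ⇔ (∀ T → P T → signSet S θ T ≡ kronecker (sqfSet S T) f))
    χ-sum {P} P? P-⊥ P-△ P⊆𝒟₀ = proj₁ signs , mk⇔
        (λ C>0 T PT → Equivalence.to (χ≡1⇔ T (P⊆𝒟₀ T PT)) (Equivalence.to (proj₂ signs) C>0 T PT))
        (λ θ≡k → Equivalence.from (proj₂ signs) (λ T PT → Equivalence.from (χ≡1⇔ T (P⊆𝒟₀ T PT)) (θ≡k T PT)))
      where
      signs : 0ℤ ≤ ∑ P? χ × (0ℤ < ∑ P? χ ⇔ (∀ T → P T → χ T ≡ 1ℤ))
      signs = character-sum P? χ (⊥ , P-⊥) P-△ (λ T PT → χ-unit T (P⊆𝒟₀ T PT))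
        (λ T U PT PU → χ-△ T U (P⊆𝒟₀ T PT) (P⊆𝒟₀ U PU))

lemma6 : (S : NonZeroIntegers) (θ : Fin (NonZeroIntegers.size S) → Sign) (f d : ℕ) .{{_ : ℕ.NonZero f}} → f ℕ.≤ d → Coprime f d →
    (0ℤ ≤ C S θ f d)
    × (4 ∤ d → (0ℤ < C S θ f d) ⇔ (∀ T → 𝒟₂ S d T → signSet S θ T ≡ kronecker (sqfSet S T) f))
    × (4 ∣ d → 8 ∤ d → (0ℤ < C S θ f d) ⇔ (∀ T → 𝒟₁ S d T → signSet S θ T ≡ kronecker (sqfSet S T) f))
    × (8 ∣ d → (0ℤ < C S θ f d) ⇔ (∀ T → 𝒟₀ S d T → signSet S θ T ≡ kronecker (sqfSet S T) f))
-- Matching on the same two decisions as `C` reduces it to the sum over a single 𝒟ᵢ; the claims for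
-- the other two cases have contradictory hypotheses.
lemma6 S θ f d _ f⊥d with 4 ℕ.∣? d | 8 ℕ.∣? d
... | no 4∤d | _ =
  proj₁ C₂ , (λ _ → proj₂ C₂) , (λ 4∣d → contradiction 4∣d 4∤d) ,
  (λ 8∣d → contradiction (ℕ.∣-trans (ℕ.divides 2 refl) 8∣d) 4∤d)
  where
  C₂ = χ-sum S θ f d f⊥d (𝒟₂? S d) (𝒟₂-⊥ S d) (𝒟₂-△ S d) (λ _ → proj₁)
... | yes 4∣d | no 8∤d =
  proj₁ C₁ , contradiction 4∣d , (λ _ _ → proj₂ C₁) , (λ 8∣d → contradiction 8∣d 8∤d)
  where
  C₁ = χ-sum S θ f d f⊥d (𝒟₁? S d) (𝒟₁-⊥ S d) (𝒟₁-△ S d) (λ _ → proj₁)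
... | yes 4∣d | yes 8∣d =
  proj₁ C₀ , contradiction 4∣d , (λ _ → contradiction 8∣d) , (λ _ → proj₂ C₀)
  where
  C₀ = χ-sum S θ f d f⊥d (𝒟₀? S d) (𝒟₀-⊥ S d) (𝒟₀-△ S d) (λ _ → id)
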